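{- Let $G$ be a connected graph on $n\ge 2$ vertices with Wiener index $W(G)$. Then $\gamma(G)\le \dfrac{n^2}{2W(G)}$, with equality if and only if $G$ is transmission-regular.
   Context: For a finite simple undirected graph $G$ with $n$ vertices, let $\mathcal{F}=\{x\in\mathbb{R}^{V(G)} : \sum_{v} x_v = 0,\ \|x\|_\infty = 1\}$, for $x\in\mathcal{F}$ let $\gamma_x(G)=\max_{uv\in E(G)}|x_u-x_v|$, and $\gamma(G)=\min_{x\in\mathcal{F}}\gamma_x(G)$. For a connected graph, $d(u,v)$ is shortest-path distance, $\operatorname{tr}(u)=\sum_v d(u,v)$, and $W(G)=\sum_{\{u,v\}}d(u,v)=\frac12\sum_u\operatorname{tr}(u)$ (sum over unordered pairs). $G$ is transmission-regular if all vertices have the same transmission. -}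

module Defs where

open import Data.Nat.Base as ℕ using (ℕ; zero; suc)
import Data.Nat.Properties as ℕP
open import Data.Nat.ListAction using (sum)
open import Data.Integer.Base using (+_)
open import Data.Rational.Base as ℚ using (ℚ; 0ℚ; 1ℚ; ½)
import Data.Rational.Properties as ℚP
open import Data.Rational.Solver using (module +-*-Solver)
open import Data.Fin.Base as Fin using (Fin)
import Data.Fin.Properties as FinP
open import Data.List.Base using (List; []; _∷_; map; foldr; filter; allFin; cartesianProduct)
open import Data.List.Membership.Propositional using (_∈_)
open import Data.List.Membership.Propositional.Properties
  using (∈-allFin; ∈-map⁺; ∈-filter⁺; ∈-cartesianProduct⁺)
open import Data.List.Relation.Unary.Any using (here; there)
open import Data.Product.Base using (∃; _×_; _,_; proj₁; proj₂; uncurry)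
open import Data.Sum.Base using (inj₁; inj₂)
open import Data.Empty using (⊥-elim)
open import Relation.Nullary using (¬_; Dec; yes; no)
open import Relation.Nullary.Decidable using (map′; _×-dec_)
open import Relation.Binary.PropositionalEquality
  using (_≡_; refl; sym; trans; cong; subst)

-- A real is a Cauchy sequence of rationals carrying its modulus of
-- convergence.  Equality of reals is _≃_ (the difference tends to 0), and
-- operations act termwise on representatives.

record ℝ : Set where
  constructor mkℝ
  field
    seq    : ℕ → ℚ
    cauchy : ∀ ε → 0ℚ ℚ.< ε → ∃ λ N → ∀ m n → N ℕ.≤ m → N ℕ.≤ n →
             ℚ.∣ seq m ℚ.- seq n ∣ ℚ.≤ ε
open ℝ public

infix 4 _≃_ _≤_

_≃_ : ℝ → ℝ → Set
x ≃ y = ∀ ε → 0ℚ ℚ.< ε → ∃ λ N → ∀ n → N ℕ.≤ n →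
        ℚ.∣ seq x n ℚ.- seq y n ∣ ℚ.≤ ε

_≤_ : ℝ → ℝ → Set
x ≤ y = ∀ ε → 0ℚ ℚ.< ε → ∃ λ N → ∀ n → N ℕ.≤ n →
        seq x n ℚ.≤ seq y n ℚ.+ ε

fromℚ : ℚ → ℝ
fromℚ q .seq _ = q
fromℚ q .cauchy ε 0<ε =
  0 , λ _ _ _ _ → subst (ℚ._≤ ε) (sym (cong ℚ.∣_∣ (ℚP.+-inverseʳ q))) (ℚP.<⇒≤ 0<ε)

0ℝ 1ℝ : ℝ
0ℝ = fromℚ 0ℚ
1ℝ = fromℚ 1ℚ

open +-*-Solver

p≤∣p∣ : ∀ p → p ℚ.≤ ℚ.∣ p ∣
p≤∣p∣ p with ℚP.≤-total 0ℚ p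
... | inj₁ 0≤p = ℚP.≤-reflexive (sym (ℚP.0≤p⇒∣p∣≡p 0≤p))
... | inj₂ p≤0 = ℚP.≤-trans p≤0 (ℚP.0≤∣p∣ p)

a≡c+[a-c] : ∀ a c → a ≡ c ℚ.+ (a ℚ.- c)
a≡c+[a-c] = solve 2 (λ a c → a := c :+ (a :- c)) refl

c≡a-[a-c] : ∀ a c → c ≡ a ℚ.+ ℚ.- (a ℚ.- c)
c≡a-[a-c] = solve 2 (λ a c → c := a :+ (:- (a :- c))) refl

a≤c+∣a-c∣ : ∀ a c → a ℚ.≤ c ℚ.+ ℚ.∣ a ℚ.- c ∣
a≤c+∣a-c∣ a c = ℚP.≤-trans (ℚP.≤-reflexive (a≡c+[a-c] a c))
  (ℚP.+-monoʳ-≤ c (p≤∣p∣ (a ℚ.- c)))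

c≤a+∣a-c∣ : ∀ a c → c ℚ.≤ a ℚ.+ ℚ.∣ a ℚ.- c ∣
c≤a+∣a-c∣ a c = ℚP.≤-trans (ℚP.≤-reflexive (c≡a-[a-c] a c))
  (ℚP.+-monoʳ-≤ a (ℚP.≤-trans (p≤∣p∣ (ℚ.- (a ℚ.- c)))
                              (ℚP.≤-reflexive (ℚP.∣-p∣≡∣p∣ (a ℚ.- c)))))

∣a-c∣≤ : ∀ {a c q} → a ℚ.≤ c ℚ.+ q → c ℚ.≤ a ℚ.+ q → ℚ.∣ a ℚ.- c ∣ ℚ.≤ q
∣a-c∣≤ {a} {c} {q} a≤ c≤ with ℚP.∣p∣≡p∨∣p∣≡-p (a ℚ.- c)
... | inj₁ e = subst (ℚ._≤ q) (sym e)
      (subst (a ℚ.- c ℚ.≤_) (solve 2 (λ c q → c :+ q :- c := q) refl c q)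
        (ℚP.+-monoˡ-≤ (ℚ.- c) a≤))
... | inj₂ e = subst (ℚ._≤ q) (sym e)
      (subst (ℚ._≤ q) (solve 2 (λ a c → c :- a := :- (a :- c)) refl a c)
        (subst (c ℚ.- a ℚ.≤_) (solve 2 (λ a q → a :+ q :- a := q) refl a q)
          (ℚP.+-monoˡ-≤ (ℚ.- a) c≤)))

NonExpansive₁ : (ℚ → ℚ) → Set
NonExpansive₁ f = ∀ a c → ℚ.∣ f a ℚ.- f c ∣ ℚ.≤ ℚ.∣ a ℚ.- c ∣

NonExpansive₂ : (ℚ → ℚ → ℚ) → Set
NonExpansive₂ f = ∀ a b c d →
  ℚ.∣ f a b ℚ.- f c d ∣ ℚ.≤ ℚ.∣ a ℚ.- c ∣ ℚ.+ ℚ.∣ b ℚ.- d ∣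

abs-nonExpansive : NonExpansive₁ ℚ.∣_∣
abs-nonExpansive a c = ∣a-c∣≤
  (ℚP.≤-trans (ℚP.≤-reflexive (cong ℚ.∣_∣ (a≡c+[a-c] a c)))
              (ℚP.∣p+q∣≤∣p∣+∣q∣ c (a ℚ.- c)))
  (ℚP.≤-trans (ℚP.≤-reflexive (cong ℚ.∣_∣ (c≡a-[a-c] a c)))
    (ℚP.≤-trans (ℚP.∣p+q∣≤∣p∣+∣q∣ a (ℚ.- (a ℚ.- c)))
      (ℚP.≤-reflexive (cong (ℚ.∣ a ∣ ℚ.+_) (ℚP.∣-p∣≡∣p∣ (a ℚ.- c))))))

+-nonExpansive : NonExpansive₂ ℚ._+_
+-nonExpansive a b c d = ℚP.≤-trans
  (ℚP.≤-reflexive (cong ℚ.∣_∣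
    (solve 4 (λ a b c d → a :+ b :- (c :+ d) := (a :- c) :+ (b :- d)) refl a b c d)))
  (ℚP.∣p+q∣≤∣p∣+∣q∣ (a ℚ.- c) (b ℚ.- d))

minus-nonExpansive : NonExpansive₂ ℚ._-_
minus-nonExpansive a b c d = ℚP.≤-trans
  (ℚP.≤-reflexive (cong ℚ.∣_∣
    (solve 4 (λ a b c d → a :- b :- (c :- d) := (a :- c) :- (b :- d)) refl a b c d)))
  (ℚP.∣p-q∣≤∣p∣+∣q∣ (a ℚ.- c) (b ℚ.- d))

⊔-nonExpansive : NonExpansive₂ ℚ._⊔_
⊔-nonExpansive a b c d = ∣a-c∣≤
  (ℚP.⊔-lub
    (ℚP.≤-trans (a≤c+∣a-c∣ a c) (ℚP.+-mono-≤ (ℚP.p≤p⊔q c d) s≤s+t))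
    (ℚP.≤-trans (a≤c+∣a-c∣ b d) (ℚP.+-mono-≤ (ℚP.p≤q⊔p c d) t≤s+t)))
  (ℚP.⊔-lub
    (ℚP.≤-trans (c≤a+∣a-c∣ a c) (ℚP.+-mono-≤ (ℚP.p≤p⊔q a b) s≤s+t))
    (ℚP.≤-trans (c≤a+∣a-c∣ b d) (ℚP.+-mono-≤ (ℚP.p≤q⊔p a b) t≤s+t)))
  where
  s = ℚ.∣ a ℚ.- c ∣
  t = ℚ.∣ b ℚ.- d ∣
  s≤s+t : s ℚ.≤ s ℚ.+ t
  s≤s+t = subst (ℚ._≤ s ℚ.+ t) (ℚP.+-identityʳ s)
            (ℚP.+-monoʳ-≤ s (ℚP.0≤∣p∣ (b ℚ.- d)))
  t≤s+t : t ℚ.≤ s ℚ.+ t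
  t≤s+t = subst (ℚ._≤ s ℚ.+ t) (ℚP.+-identityˡ t)
            (ℚP.+-monoˡ-≤ t (ℚP.0≤∣p∣ (a ℚ.- c)))

lift₁ : (f : ℚ → ℚ) → NonExpansive₁ f → ℝ → ℝ
lift₁ f f-ne x .seq n = f (seq x n)
lift₁ f f-ne x .cauchy ε 0<ε with cauchy x ε 0<ε
... | N , x-cauchy = N , λ m n N≤m N≤n →
  ℚP.≤-trans (f-ne (seq x m) (seq x n)) (x-cauchy m n N≤m N≤n)

0<½ε : ∀ {ε} → 0ℚ ℚ.< ε → 0ℚ ℚ.< ½ ℚ.* ε
0<½ε {ε} 0<ε = subst (ℚ._< ½ ℚ.* ε) (ℚP.*-zeroʳ ½) (ℚP.*-monoʳ-<-pos ½ 0<ε)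

½ε+½ε≡ε : ∀ ε → ½ ℚ.* ε ℚ.+ ½ ℚ.* ε ≡ ε
½ε+½ε≡ε ε = trans (sym (ℚP.*-distribʳ-+ ε ½ ½)) (ℚP.*-identityˡ ε)

lift₂ : (f : ℚ → ℚ → ℚ) → NonExpansive₂ f → ℝ → ℝ → ℝ
lift₂ f f-ne x y .seq n = f (seq x n) (seq y n)
lift₂ f f-ne x y .cauchy ε 0<ε
  with cauchy x (½ ℚ.* ε) (0<½ε 0<ε) | cauchy y (½ ℚ.* ε) (0<½ε 0<ε)
... | M , x-cauchy | N , y-cauchy = M ℕ.⊔ N , λ m n h k →
  subst (ℚ.∣ f (seq x m) (seq y m) ℚ.- f (seq x n) (seq y n) ∣ ℚ.≤_)
    (½ε+½ε≡ε ε)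
    (ℚP.≤-trans (f-ne (seq x m) (seq y m) (seq x n) (seq y n))
      (ℚP.+-mono-≤
        (x-cauchy m n (ℕP.m⊔n≤o⇒m≤o M N h) (ℕP.m⊔n≤o⇒m≤o M N k))
        (y-cauchy m n (ℕP.m⊔n≤o⇒n≤o M N h) (ℕP.m⊔n≤o⇒n≤o M N k))))

≤-respʳ-≃ : ∀ {x y z} → x ≤ y → y ≃ z → x ≤ z
≤-respʳ-≃ {x} {y} {z} x≤y y≃z ε 0<ε
  with x≤y (½ ℚ.* ε) (0<½ε 0<ε) | y≃z (½ ℚ.* ε) (0<½ε 0<ε)
... | M , p | N , q = M ℕ.⊔ N , λ n h →
  let yₙ = seq y n ; zₙ = seq z n ; δ = ½ ℚ.* ε in
  ℚP.≤-trans (p n (ℕP.m⊔n≤o⇒m≤o M N h))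
    (ℚP.≤-trans
      (ℚP.+-monoˡ-≤ δ (ℚP.≤-trans (a≤c+∣a-c∣ yₙ zₙ)
                         (ℚP.+-monoʳ-≤ zₙ (q n (ℕP.m⊔n≤o⇒n≤o M N h)))))
      (ℚP.≤-reflexive (trans (ℚP.+-assoc zₙ δ δ) (cong (zₙ ℚ.+_) (½ε+½ε≡ε ε)))))

≤-antisym : ∀ {x y} → x ≤ y → y ≤ x → x ≃ y
≤-antisym x≤y y≤x ε 0<ε with x≤y ε 0<ε | y≤x ε 0<ε
... | M , p | N , q = M ℕ.⊔ N , λ n h →
  ∣a-c∣≤ (p n (ℕP.m⊔n≤o⇒m≤o M N h)) (q n (ℕP.m⊔n≤o⇒n≤o M N h))

infixl 6 _+_ _-_ _⊔_

_+_ _-_ _⊔_ : ℝ → ℝ → ℝ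
_+_ = lift₂ ℚ._+_ +-nonExpansive
_-_ = lift₂ ℚ._-_ minus-nonExpansive
_⊔_ = lift₂ ℚ._⊔_ ⊔-nonExpansive

∣_∣ : ℝ → ℝ
∣_∣ = lift₁ ℚ.∣_∣ abs-nonExpansive

sumℝ : List ℝ → ℝ
sumℝ = foldr _+_ 0ℝ

-- Only applied to lists of absolute values, so starting at 0 does not change
-- the maximum of a nonempty list.
maxℝ : List ℝ → ℝ
maxℝ = foldr _⊔_ 0ℝ

record SimpleGraph (n : ℕ) : Set₁ where
  infix 4 _~_ _~?_
  field
    _~_      : Fin n → Fin n → Set
    _~?_     : ∀ u v → Dec (u ~ v)
    ~-sym    : ∀ {u v} → u ~ v → v ~ u
    ~-irrefl : ∀ {v} → ¬ (v ~ v)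

-- Each unordered pair {u , v} of distinct vertices is listed once, as the
-- pair with u < v.
pairs : ∀ n → List (Fin n × Fin n)
pairs n = filter (λ (u , v) → u FinP.<? v) (cartesianProduct (allFin n) (allFin n))

least : ∀ {P : ℕ → Set} → (∀ k → Dec (P k)) → ∀ k → P k →
        ∃ λ m → P m × (∀ j → P j → m ℕ.≤ j)
least P? k Pk with P? 0
... | yes P0 = 0 , P0 , λ _ _ → ℕ.z≤n
least P? zero    Pk | no ¬P0 = ⊥-elim (¬P0 Pk)
least P? (suc k) Pk | no ¬P0 with least (λ j → P? (suc j)) k Pk
... | m , Pm , m-least = suc m , Pm , λ where
  zero    P0 → ⊥-elim (¬P0 P0)
  (suc j) Pj → ℕ.s≤s (m-least j Pj)

module _ {n : ℕ} (G : SimpleGraph n) where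
  open SimpleGraph G

  edges : List (Fin n × Fin n)
  edges = filter (λ (u , v) → u ~? v) (pairs n)

  data Walk : ℕ → Fin n → Fin n → Set where
    stop : ∀ {u} → Walk 0 u u
    step : ∀ {k u w v} → u ~ w → Walk k w v → Walk (suc k) u v

  walk? : ∀ u v k → Dec (Walk k u v)
  walk? u v zero    = map′ (λ { refl → stop }) (λ { stop → refl }) (u FinP.≟ v)
  walk? u v (suc k) = map′ (λ (_ , e , p) → step e p) (λ { (step e p) → _ , e , p })
                        (FinP.any? λ w → (u ~? w) ×-dec walk? w v k)

  Connected : Set
  Connected = ∀ u v → ∃ λ k → Walk k u v

  module _ (conn : Connected) where

    -- A walk of minimum length is a path, so this is shortest-path distance.
    shortest : ∀ u v → ∃ λ m → Walk m u v × (∀ j → Walk j u v → m ℕ.≤ j)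
    shortest u v = least (walk? u v) (proj₁ (conn u v)) (proj₂ (conn u v))

    d : Fin n → Fin n → ℕ
    d u v = proj₁ (shortest u v)

    tr : Fin n → ℕ
    tr u = sum (map (d u) (allFin n))

    W : ℕ
    W = sum (map (uncurry d) (pairs n))

    TransmissionRegular : Set
    TransmissionRegular = ∀ u v → tr u ≡ tr v

‖_‖∞ : ∀ {n} → (Fin n → ℝ) → ℝ
‖_‖∞ {n} x = maxℝ (map (λ v → ∣ x v ∣) (allFin n))

𝓕 : ∀ n → (Fin n → ℝ) → Set
𝓕 n x = sumℝ (map x (allFin n)) ≃ 0ℝ × ‖ x ‖∞ ≃ 1ℝ

γ[_,_] : ∀ {n} → (Fin n → ℝ) → SimpleGraph n → ℝ
γ[ x , G ] = maxℝ (map (λ (u , v) → ∣ x u - x v ∣) (edges G))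

-- g = γ(G): the real g is the minimum, attained, of γ[ x , G ] over 𝓕.
Is-γ : ∀ {n} → SimpleGraph n → ℝ → Set
Is-γ {n} G g = (∃ λ x → 𝓕 n x × γ[ x , G ] ≃ g)
             × (∀ x → 𝓕 n x → g ≤ γ[ x , G ])

Is-γ-unique : ∀ {n} {G : SimpleGraph n} {g h} → Is-γ G g → Is-γ G h → g ≃ h
Is-γ-unique {G = G} {g} {h} ((x , x∈𝓕 , x-attains) , g-min) ((y , y∈𝓕 , y-attains) , h-min) =
  ≤-antisym {g} {h} (≤-respʳ-≃ {g} {γ[ y , G ]} {h} (g-min y y∈𝓕) y-attains)
                    (≤-respʳ-≃ {h} {γ[ x , G ]} {g} (h-min x x∈𝓕) x-attains)

∈⇒≤sum : ∀ {k ks} → k ∈ ks → k ℕ.≤ sum ks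
∈⇒≤sum (here refl)           = ℕP.m≤m+n _ _
∈⇒≤sum (there {x = k} k∈ks) = ℕP.≤-trans (∈⇒≤sum k∈ks) (ℕP.m≤n+m _ k)

2W≢0 : ∀ {n} → 2 ℕ.≤ n → (G : SimpleGraph n) (conn : Connected G) →
       ℕ.NonZero (2 ℕ.* W G conn)
2W≢0 {suc (suc n)} (ℕ.s≤s (ℕ.s≤s _)) G conn =
  ℕP.m*n≢0 2 (W G conn) {{_}} {{ℕ.>-nonZero (ℕP.≤-trans d₀₁>0 d₀₁≤W)}}
  where
  v₀ v₁ : Fin (suc (suc n))
  v₀ = Fin.zero
  v₁ = Fin.suc Fin.zero

  positive : ∀ {k} → Walk G k v₀ v₁ → 0 ℕ.< k
  positive (step _ _) = ℕ.s≤s ℕ.z≤n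

  d₀₁>0 : 0 ℕ.< d G conn v₀ v₁
  d₀₁>0 = positive (proj₁ (proj₂ (shortest G conn v₀ v₁)))

  d₀₁≤W : d G conn v₀ v₁ ℕ.≤ W G conn
  d₀₁≤W = ∈⇒≤sum (∈-map⁺ (uncurry (d G conn))
    (∈-filter⁺ (λ (u , v) → u FinP.<? v)
      (∈-cartesianProduct⁺ (∈-allFin v₀) (∈-allFin v₁)) (ℕ.s≤s ℕ.z≤n)))

{-# OPTIONS --safe #-}
-- γ(G) = n / T, where T is the largest transmission.  If x sums to 0 and
-- |x u| = 1, then along geodesics |x u − x v| ≤ γ_x d(u,v), and summing over v
-- gives n ≤ γ_x tr(u) ≤ γ_x T.  Equality holds for x v = 1 − (n/T) d(c,v) with c of
-- transmission T; it lies in 𝓕 because n d(c,v) ≤ tr(c) + tr(v) ≤ 2T.  Finally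
-- 2W = Σ tr(u) ≤ nT, with equality exactly in the transmission-regular case.
-- For Cauchy reals the hypotheses on x hold only in the limit, so the lower bound
-- is proved for each rational term with an error controlled by |Σ x|.

module Submission where

open import Defs
open import Data.Nat.Base as ℕ using (ℕ; suc)
import Data.Nat.Properties as ℕP
import Data.Nat.Coprimality as Coprimality
open import Data.Nat.ListAction using (sum)
open import Data.Nat.ListAction.Properties using (sum-++)
open import Data.Nat.Tactic.RingSolver using (solve-∀)
open import Data.Integer.Base as ℤ using (+_)
import Data.Integer.Properties as ℤP
open import Data.Rational.Base as ℚ using (ℚ; 0ℚ; 1ℚ)
import Data.Rational.Properties as ℚP
open import Data.Rational.Solver using (module +-*-Solver)
open import Data.Rational.Unnormalised.Base as ℚᵘ using (mkℚᵘ)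
import Data.Rational.Unnormalised.Properties as ℚᵘP
open import Data.Fin.Base as Fin using (Fin)
import Data.Fin.Properties as FinP
open import Data.Bool.Base using (if_then_else_)
open import Data.List.Base
  using (List; []; _∷_; _++_; map; foldr; filter; length; allFin; cartesianProduct)
open import Data.List.Properties using (map-cong; map-∘; map-++; length-tabulate)
open import Data.List.Extrema.Nat using (argmax; f[xs]≤f[argmax])
open import Data.List.Membership.Propositional using (_∈_)
open import Data.List.Membership.Propositional.Properties
  using (∈-allFin; ∈-filter⁺; ∈-filter⁻; ∈-cartesianProduct⁺)
open import Data.List.Relation.Unary.Any using (here; there)
import Data.List.Relation.Unary.All as All
open import Data.Product.Base using (∃; _×_; _,_; proj₁; proj₂; uncurry)
open import Data.Sum.Base using (inj₁; inj₂)
open import Function.Base using (id; _∘_)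
open import Function.Bundles using (_⇔_; mk⇔)
open import Relation.Binary.Definitions using (tri<; tri≈; tri>)
open import Relation.Nullary.Decidable using (dec-true; dec-false)
open import Relation.Nullary using (¬_; Dec; yes; no; does; contradiction)
open import Relation.Binary.PropositionalEquality
  using (_≡_; refl; sym; trans; cong; cong₂; subst; subst₂; module ≡-Reasoning)

open +-*-Solver using (solve; _:=_; _:+_; _:*_; _:-_; :-_; con)

-- Natural numbers and their fractions inside the rationals.

ι : ℕ → ℚ
ι n = ℚ.mkℚ (+ n) 0 (Coprimality.sym (Coprimality.1-coprimeTo n))

ι-+ : ∀ m n → ι (m ℕ.+ n) ≡ ι m ℚ.+ ι n
ι-+ m n = ℚP.toℚᵘ-injective (ℚᵘP.≃-trans
  (ℚᵘ.*≡* (cong (ℤ._* ℤ.1ℤ)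
    (sym (cong₂ ℤ._+_ (ℤP.*-identityʳ (+ m)) (ℤP.*-identityʳ (+ n))))))
  (ℚᵘP.≃-sym (ℚP.toℚᵘ-homo-+ (ι m) (ι n))))

ι-* : ∀ m n → ι (m ℕ.* n) ≡ ι m ℚ.* ι n
ι-* m n = ℚP.toℚᵘ-injective (ℚᵘP.≃-trans
  (ℚᵘ.*≡* (cong (ℤ._* ℤ.1ℤ) (ℤP.pos-* m n)))
  (ℚᵘP.≃-sym (ℚP.toℚᵘ-homo-* (ι m) (ι n))))

ι-mono : ∀ {m n} → m ℕ.≤ n → ι m ℚ.≤ ι n
ι-mono m≤n = ℚ.*≤* (ℤP.*-monoʳ-≤-nonNeg ℤ.1ℤ (ℤ.+≤+ m≤n))

ι-pos : ∀ n .{{_ : ℕ.NonZero n}} → ℚ.Positive (ι n)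
ι-pos (suc _) = _

/-*-cancel : ∀ m n .{{_ : ℕ.NonZero n}} → (+ m ℚ./ n) ℚ.* ι n ≡ ι m
/-*-cancel m (suc n) = ℚP.toℚᵘ-injective (ℚᵘP.≃-trans
  (ℚP.toℚᵘ-homo-* (+ m ℚ./ suc n) (ι (suc n)))
  (ℚᵘP.≃-trans
    (ℚᵘP.*-congʳ {mkℚᵘ (+ suc n) 0} (ℚP.toℚᵘ-fromℚᵘ (mkℚᵘ (+ m) n)))
    (ℚᵘ.*≡* (ℤP.*-assoc (+ m) (+ suc n) ℤ.1ℤ))))

/-mono-≤ : ∀ a c b d .{{_ : ℕ.NonZero b}} .{{_ : ℕ.NonZero d}} →
           a ℕ.* d ℕ.≤ c ℕ.* b → + a ℚ./ b ℚ.≤ + c ℚ./ d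
/-mono-≤ a c b@(suc b-1) d@(suc d-1) ad≤cb = ℚP.toℚᵘ-cancel-≤
  (ℚᵘP.≤-respˡ-≃ (ℚᵘP.≃-sym (ℚP.toℚᵘ-fromℚᵘ (mkℚᵘ (+ a) b-1)))
  (ℚᵘP.≤-respʳ-≃ (ℚᵘP.≃-sym (ℚP.toℚᵘ-fromℚᵘ (mkℚᵘ (+ c) d-1)))
    (ℚᵘ.*≤* (subst₂ ℤ._≤_ (ℤP.pos-* a d) (ℤP.pos-* c b) (ℤ.+≤+ ad≤cb)))))

/-injective-≃ : ∀ a c b d .{{_ : ℕ.NonZero b}} .{{_ : ℕ.NonZero d}} →
                + a ℚ./ b ≡ + c ℚ./ d → a ℕ.* d ≡ c ℕ.* b
/-injective-≃ a c b@(suc _) d@(suc _) = ℚP.normalize-injective-≃ a c b d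

-- Finite sums and maxima over lists.

sumℚ maxℚ : List ℚ → ℚ
sumℚ = foldr ℚ._+_ 0ℚ
maxℚ = foldr ℚ._⊔_ 0ℚ

module _ {A : Set} where

  -- Operations on reals act termwise. This and `seq-maxℝ` move every estimate to the rationals, one
  -- index at a time.
  seq-sumℝ : ∀ (f : A → ℝ) xs k → seq (sumℝ (map f xs)) k ≡ sumℚ (map (λ a → seq (f a) k) xs)
  seq-sumℝ f []       k = refl
  seq-sumℝ f (a ∷ xs) k = cong (seq (f a) k ℚ.+_) (seq-sumℝ f xs k)

  seq-maxℝ : ∀ (f : A → ℝ) xs k → seq (maxℝ (map f xs)) k ≡ maxℚ (map (λ a → seq (f a) k) xs)
  seq-maxℝ f []       k = refl
  seq-maxℝ f (a ∷ xs) k = cong (seq (f a) k ℚ.⊔_) (seq-maxℝ f xs k)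

  ∈⇒≤maxℚ : ∀ (f : A → ℚ) {a xs} → a ∈ xs → f a ℚ.≤ maxℚ (map f xs)
  ∈⇒≤maxℚ f {xs = a ∷ xs} (here refl) = ℚP.p≤p⊔q (f a) (maxℚ (map f xs))
  ∈⇒≤maxℚ f {xs = b ∷ xs} (there a∈xs) =
    ℚP.≤-trans (∈⇒≤maxℚ f a∈xs) (ℚP.p≤q⊔p (f b) (maxℚ (map f xs)))

  0≤maxℚ : ∀ (f : A → ℚ) xs → 0ℚ ℚ.≤ maxℚ (map f xs)
  0≤maxℚ f []       = ℚP.≤-refl
  0≤maxℚ f (a ∷ xs) = ℚP.≤-trans (0≤maxℚ f xs) (ℚP.p≤q⊔p (f a) (maxℚ (map f xs)))

  maxℚ-lub : ∀ (f : A → ℚ) {r} xs → 0ℚ ℚ.≤ r → (∀ {a} → a ∈ xs → f a ℚ.≤ r) →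
             maxℚ (map f xs) ℚ.≤ r
  maxℚ-lub f []       0≤r f≤r = 0≤r
  maxℚ-lub f (a ∷ xs) 0≤r f≤r =
    ℚP.⊔-lub (f≤r (here refl)) (maxℚ-lub f xs 0≤r (f≤r ∘ there))

  -- The fold starts at 0, so for the empty list the supplied element is a witness by nonnegativity;
  -- the witness need not lie in `xs`.
  maxℚ-attained : ∀ (f : A → ℚ) → (∀ a → 0ℚ ℚ.≤ f a) → A → ∀ xs →
                  ∃ λ a → maxℚ (map f xs) ℚ.≤ f a
  maxℚ-attained f 0≤f a []       = a , 0≤f a
  maxℚ-attained f 0≤f a (b ∷ xs) with maxℚ-attained f 0≤f a xs
  ... | c , max≤fc with ℚP.≤-total (f b) (f c)
  ...   | inj₁ fb≤fc = c , ℚP.⊔-lub fb≤fc max≤fc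
  ...   | inj₂ fc≤fb = b , ℚP.⊔-lub ℚP.≤-refl (ℚP.≤-trans max≤fc fc≤fb)

  -- Evaluates the sum of the extremal vector: there `q` is n/T and `f` is the distance from a
  -- vertex of transmission T, so the right side becomes n - n.
  sum-affine : ∀ (q : ℚ) (f : A → ℕ) xs →
    sumℚ (map (λ a → 1ℚ ℚ.- q ℚ.* ι (f a)) xs) ≡ ι (length xs) ℚ.- q ℚ.* ι (sum (map f xs))
  -- `ι 0` computes to `0ℚ`, which makes the empty case a ring identity.
  sum-affine q f []       = solve 1 (λ q → con 0ℚ := con 0ℚ :- q :* con 0ℚ) refl q
  sum-affine q f (a ∷ xs) = begin
    1ℚ ℚ.- q ℚ.* ι (f a) ℚ.+ sumℚ (map (λ a → 1ℚ ℚ.- q ℚ.* ι (f a)) xs)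
      ≡⟨ cong (1ℚ ℚ.- q ℚ.* ι (f a) ℚ.+_) (sum-affine q f xs) ⟩
    1ℚ ℚ.- q ℚ.* ι (f a) ℚ.+ (ι l ℚ.- q ℚ.* ι s)
      ≡⟨ solve 4 (λ q i l s → con 1ℚ :- q :* i :+ (l :- q :* s) := con 1ℚ :+ l :- q :* (i :+ s))
           refl q (ι (f a)) (ι l) (ι s) ⟩
    1ℚ ℚ.+ ι l ℚ.- q ℚ.* (ι (f a) ℚ.+ ι s)
      ≡⟨ cong₂ (λ i j → i ℚ.- q ℚ.* j) (ι-+ 1 l) (ι-+ (f a) s) ⟨
    ι (suc l) ℚ.- q ℚ.* ι (f a ℕ.+ s) ∎
    where
    open ≡-Reasoning
    l = length xs
    s = sum (map f xs)

  -- Meant for `f` the distance from a vertex u, `s` the sign of `y u` and `c` its absolute value;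
  -- the right side then becomes tr(u) times `g`.
  sum-deviation-≤ : ∀ (c s g : ℚ) (y : A → ℚ) (f : A → ℕ) xs →
    (∀ a → c ℚ.- s ℚ.* y a ℚ.≤ ι (f a) ℚ.* g) →
    ι (length xs) ℚ.* c ℚ.- s ℚ.* sumℚ (map y xs) ℚ.≤ ι (sum (map f xs)) ℚ.* g
  sum-deviation-≤ c s g y f []       h = ℚP.≤-reflexive
    (solve 3 (λ c s g → con 0ℚ :* c :- s :* con 0ℚ := con 0ℚ :* g) refl c s g)
  sum-deviation-≤ c s g y f (a ∷ xs) h = begin
    ι (suc l) ℚ.* c ℚ.- s ℚ.* (y a ℚ.+ Y)
      ≡⟨ cong (λ i → i ℚ.* c ℚ.- s ℚ.* (y a ℚ.+ Y)) (ι-+ 1 l) ⟩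
    (1ℚ ℚ.+ ι l) ℚ.* c ℚ.- s ℚ.* (y a ℚ.+ Y)
      ≡⟨ solve 5 (λ l c s y Y → (con 1ℚ :+ l) :* c :- s :* (y :+ Y)
                             := (c :- s :* y) :+ (l :* c :- s :* Y))
           refl (ι l) c s (y a) Y ⟩
    (c ℚ.- s ℚ.* y a) ℚ.+ (ι l ℚ.* c ℚ.- s ℚ.* Y)
      ≤⟨ ℚP.+-mono-≤ (h a) (sum-deviation-≤ c s g y f xs h) ⟩
    ι (f a) ℚ.* g ℚ.+ ι F ℚ.* g
      ≡⟨ ℚP.*-distribʳ-+ g (ι (f a)) (ι F) ⟨
    (ι (f a) ℚ.+ ι F) ℚ.* g
      ≡⟨ cong (ℚ._* g) (ι-+ (f a) F) ⟨
    ι (f a ℕ.+ F) ℚ.* g ∎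
    where
    open ℚP.≤-Reasoning
    l = length xs
    Y = sumℚ (map y xs)
    F = sum (map f xs)

  sum-map-+ : ∀ (f g : A → ℕ) xs →
              sum (map (λ a → f a ℕ.+ g a) xs) ≡ sum (map f xs) ℕ.+ sum (map g xs)
  sum-map-+ f g []       = refl
  sum-map-+ f g (a ∷ xs) rewrite sum-map-+ f g xs = interchange (f a) (g a) _ _
    where
    interchange : ∀ a b c d → (a ℕ.+ b) ℕ.+ (c ℕ.+ d) ≡ (a ℕ.+ c) ℕ.+ (b ℕ.+ d)
    interchange = solve-∀

  sum-map-const : ∀ k (xs : List A) → sum (map (λ _ → k) xs) ≡ length xs ℕ.* k
  sum-map-const k []       = refl
  sum-map-const k (a ∷ xs) = cong (k ℕ.+_) (sum-map-const k xs)

  sum-map-mono : ∀ {f g : A → ℕ} → (∀ a → f a ℕ.≤ g a) → ∀ xs → sum (map f xs) ℕ.≤ sum (map g xs)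
  sum-map-mono f≤g []       = ℕ.z≤n
  sum-map-mono f≤g (a ∷ xs) = ℕP.+-mono-≤ (f≤g a) (sum-map-mono f≤g xs)

  -- The terms other than `a` already satisfy the inequality from `f` to `g`, so they can be
  -- cancelled from the reversed inequality of totals. This drives the equality case.
  sum-map-mono-tight : ∀ {f g : A → ℕ} → (∀ a → f a ℕ.≤ g a) → ∀ {a xs} →
                       sum (map g xs) ℕ.≤ sum (map f xs) → a ∈ xs → g a ℕ.≤ f a
  sum-map-mono-tight {f} {g} f≤g {xs = a ∷ xs} h (here refl) =
    ℕP.+-cancelʳ-≤ (sum (map f xs)) (g a) (f a)
      (ℕP.≤-trans (ℕP.+-monoʳ-≤ (g a) (sum-map-mono f≤g xs)) h)
  sum-map-mono-tight {f} {g} f≤g {xs = b ∷ xs} h (there a∈xs) =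
    sum-map-mono-tight f≤g (ℕP.+-cancelˡ-≤ (f b) _ _ (ℕP.≤-trans (ℕP.+-monoˡ-≤ _ (f≤g b)) h)) a∈xs

  -- Replaces filtering by zero weights, so that a sum over unordered pairs becomes a double sum
  -- over all ordered pairs, whose order can be exchanged.
  restrict : {P : A → Set} → (∀ a → Dec (P a)) → (A → ℕ) → A → ℕ
  restrict P? f a = if does (P? a) then f a else 0

  restrict-accept : ∀ {P : A → Set} (P? : ∀ a → Dec (P a)) f {a} → P a → restrict P? f a ≡ f a
  restrict-accept P? f {a} Pa rewrite dec-true (P? a) Pa = refl

  restrict-reject : ∀ {P : A → Set} (P? : ∀ a → Dec (P a)) f {a} → ¬ P a → restrict P? f a ≡ 0
  restrict-reject P? f {a} ¬Pa rewrite dec-false (P? a) ¬Pa = refl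

  sum-map-filter : ∀ {P : A → Set} (P? : ∀ a → Dec (P a)) f xs →
                   sum (map f (filter P? xs)) ≡ sum (map (restrict P? f) xs)
  sum-map-filter P? f []       = refl
  sum-map-filter P? f (a ∷ xs) with P? a
  ... | yes _ = cong (f a ℕ.+_) (sum-map-filter P? f xs)
  ... | no  _ = sum-map-filter P? f xs

module _ {A B : Set} where

  sum-map-cartesianProduct : ∀ (f : A × B → ℕ) xs ys →
    sum (map f (cartesianProduct xs ys)) ≡ sum (map (λ a → sum (map (λ b → f (a , b)) ys)) xs)
  sum-map-cartesianProduct f []       ys = refl
  sum-map-cartesianProduct f (a ∷ xs) ys = begin
    sum (map f (map (a ,_) ys ++ cartesianProduct xs ys))
      ≡⟨ cong sum (map-++ f (map (a ,_) ys) (cartesianProduct xs ys)) ⟩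
    sum (map f (map (a ,_) ys) ++ map f (cartesianProduct xs ys))
      ≡⟨ sum-++ (map f (map (a ,_) ys)) (map f (cartesianProduct xs ys)) ⟩
    sum (map f (map (a ,_) ys)) ℕ.+ sum (map f (cartesianProduct xs ys))
      ≡⟨ cong₂ ℕ._+_ (cong sum (sym (map-∘ ys))) (sum-map-cartesianProduct f xs ys) ⟩
    sum (map (λ b → f (a , b)) ys) ℕ.+ sum (map (λ a → sum (map (λ b → f (a , b)) ys)) xs) ∎
    where open ≡-Reasoning

  sum-map-swap : ∀ (f : A → B → ℕ) xs ys →
    sum (map (λ a → sum (map (f a) ys)) xs) ≡ sum (map (λ b → sum (map (λ a → f a b) xs)) ys)
  sum-map-swap f []       ys = sym (trans (sum-map-const 0 ys) (ℕP.*-zeroʳ (length ys)))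
  sum-map-swap f (a ∷ xs) ys = trans
    (cong (sum (map (f a) ys) ℕ.+_) (sum-map-swap f xs ys))
    (sym (sum-map-+ (f a) (λ b → sum (map (λ a → f a b) xs)) ys))

-- From termwise rational facts to real ones, and back for constants.

pointwise⇒≤ : ∀ {x y} → (∀ k → seq x k ℚ.≤ seq y k) → x ≤ y
pointwise⇒≤ {x} {y} h ε 0<ε = 0 , λ k _ → ℚP.≤-trans (h k)
  (subst (ℚ._≤ seq y k ℚ.+ ε) (ℚP.+-identityʳ (seq y k)) (ℚP.+-monoʳ-≤ (seq y k) (ℚP.<⇒≤ 0<ε)))

pointwise⇒≃ : ∀ {x y} → (∀ k → seq x k ≡ seq y k) → x ≃ y
pointwise⇒≃ {x} {y} h = ≤-antisym {x} {y}
  (pointwise⇒≤ {x} {y} (ℚP.≤-reflexive ∘ h))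
  (pointwise⇒≤ {y} {x} (ℚP.≤-reflexive ∘ sym ∘ h))

-- If the distance of `p` and `r` were positive, density would give an ε strictly between 0 and it,
-- against closeness within ε. Equality of reals in the theorem thus becomes an equation of
-- fractions.
fromℚ-injective : ∀ {p r} → fromℚ p ≃ fromℚ r → p ≡ r
fromℚ-injective {p} {r} p≃r with 0ℚ ℚP.<? ℚ.∣ p ℚ.- r ∣
... | yes 0<∣p-r∣ with ℚP.<-dense 0<∣p-r∣
...   | ε , 0<ε , ε<∣p-r∣ with p≃r ε 0<ε
...     | N , h = contradiction (ℚP.<-≤-trans ε<∣p-r∣ (h N ℕP.≤-refl)) (ℚP.<-irrefl refl)
fromℚ-injective {p} {r} p≃r | no ∣p-r∣≯0 = begin
  p              ≡⟨ a≡c+[a-c] p r ⟩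
  r ℚ.+ (p ℚ.- r) ≡⟨ cong (r ℚ.+_) (ℚP.∣p∣≡0⇒p≡0 (p ℚ.- r) ∣p-r∣≡0) ⟩
  r ℚ.+ 0ℚ       ≡⟨ ℚP.+-identityʳ r ⟩
  r              ∎
  where
  open ≡-Reasoning
  ∣p-r∣≡0 : ℚ.∣ p ℚ.- r ∣ ≡ 0ℚ
  ∣p-r∣≡0 = ℚP.≤-antisym (ℚP.≮⇒≥ ∣p-r∣≯0) (ℚP.0≤∣p∣ (p ℚ.- r))

-- The factor is 1 or -1. It lets both signs of an extreme entry be treated at once, while the last
-- clause bounds the scaled differences and the scaled sum.
sign : ∀ p → ∃ λ s → s ℚ.* p ≡ ℚ.∣ p ∣ × (∀ r → s ℚ.* r ℚ.≤ ℚ.∣ r ∣)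
sign p with ℚP.∣p∣≡p∨∣p∣≡-p p
... | inj₁ e = 1ℚ , trans (ℚP.*-identityˡ p) (sym e) ,
  λ r → ℚP.≤-trans (ℚP.≤-reflexive (ℚP.*-identityˡ r)) (p≤∣p∣ r)
... | inj₂ e = ℚ.- 1ℚ , trans (-1*r≡-r p) (sym e) ,
  λ r → ℚP.≤-trans (ℚP.≤-reflexive (-1*r≡-r r))
          (ℚP.≤-trans (p≤∣p∣ (ℚ.- r)) (ℚP.≤-reflexive (ℚP.∣-p∣≡∣p∣ r)))
  where
  -1*r≡-r : ∀ r → ℚ.- 1ℚ ℚ.* r ≡ ℚ.- r
  -1*r≡-r r = trans (sym (ℚP.neg-distribˡ-* 1ℚ r)) (cong ℚ.-_ (ℚP.*-identityˡ r))

length-allFin : ∀ n → length (allFin n) ≡ n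
length-allFin n = length-tabulate id

-- Variation of a rational vector along edges and walks.

module _ {n : ℕ} (G : SimpleGraph n) where
  open SimpleGraph G

  -- The rational counterpart of `γ[ x , G ]`: applied to the k-th terms of `x`, it is the k-th term
  -- of that real.
  spread : (Fin n → ℚ) → ℚ
  spread y = maxℚ (map (λ (u , v) → ℚ.∣ y u ℚ.- y v ∣) (edges G))

  -- `edges` lists an edge with its smaller endpoint first; the opposite orientation follows from
  -- the symmetry of the absolute value.
  edge≤spread : ∀ y {u v} → u ~ v → ℚ.∣ y u ℚ.- y v ∣ ℚ.≤ spread y
  edge≤spread y {u} {v} u~v with FinP.<-cmp u v
  ... | tri< u<v _ _ = ∈⇒≤maxℚ (λ (u , v) → ℚ.∣ y u ℚ.- y v ∣)
        (∈-filter⁺ (λ (u , v) → u ~? v)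
          (∈-filter⁺ (λ (u , v) → u FinP.<? v)
            (∈-cartesianProduct⁺ (∈-allFin u) (∈-allFin v)) u<v) u~v)
  ... | tri≈ _ refl _ = contradiction u~v ~-irrefl
  ... | tri> _ _ v<u = subst (ℚ._≤ spread y)
        (trans (sym (ℚP.∣-p∣≡∣p∣ (y v ℚ.- y u)))
          (cong ℚ.∣_∣ (solve 2 (λ a b → :- (a :- b) := b :- a) refl (y v) (y u))))
        (∈⇒≤maxℚ (λ (u , v) → ℚ.∣ y u ℚ.- y v ∣)
          (∈-filter⁺ (λ (u , v) → u ~? v)
            (∈-filter⁺ (λ (u , v) → u FinP.<? v)
              (∈-cartesianProduct⁺ (∈-allFin v) (∈-allFin u)) v<u) (~-sym u~v)))

  spread≤ : ∀ y {g} → 0ℚ ℚ.≤ g → (∀ {u v} → u ~ v → ℚ.∣ y u ℚ.- y v ∣ ℚ.≤ g) → spread y ℚ.≤ g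
  spread≤ y 0≤g h = maxℚ-lub (λ (u , v) → ℚ.∣ y u ℚ.- y v ∣) (edges G) 0≤g
    (λ e∈ → h (proj₂ (∈-filter⁻ (λ (u , v) → u ~? v) {xs = pairs n} e∈)))

  -- The difference telescopes along the walk, and each of its `k` edges contributes at most `g`.
  walk-deviation-≤ : ∀ {g} (z : Fin n → ℚ) → (∀ {u v} → u ~ v → z u ℚ.- z v ℚ.≤ g) →
                     ∀ {k u v} → Walk G k u v → z u ℚ.- z v ℚ.≤ ι k ℚ.* g
  walk-deviation-≤ {g} z h {u = u} stop = ℚP.≤-reflexive
    (solve 2 (λ a g → a :- a := con 0ℚ :* g) refl (z u) g)
  walk-deviation-≤ {g} z h {suc k} {u} {v} (step {w = w} u~w p) = begin
    z u ℚ.- z v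
      ≡⟨ solve 3 (λ a b c → a :- b := (a :- c) :+ (c :- b)) refl (z u) (z v) (z w) ⟩
    (z u ℚ.- z w) ℚ.+ (z w ℚ.- z v)
      ≤⟨ ℚP.+-mono-≤ (h u~w) (walk-deviation-≤ z h p) ⟩
    g ℚ.+ ι k ℚ.* g
      ≡⟨ solve 2 (λ k g → g :+ k :* g := (con 1ℚ :+ k) :* g) refl (ι k) g ⟩
    (1ℚ ℚ.+ ι k) ℚ.* g
      ≡⟨ cong (ℚ._* g) (ι-+ 1 k) ⟨
    ι (suc k) ℚ.* g ∎
    where open ℚP.≤-Reasoning

  _++ʷ_ : ∀ {j k u v w} → Walk G j u v → Walk G k v w → Walk G (j ℕ.+ k) u w
  stop     ++ʷ q = q
  step e p ++ʷ q = step e (p ++ʷ q)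

  snoc : ∀ {k u v w} → Walk G k u v → v ~ w → Walk G (suc k) u w
  snoc stop       e = step e stop
  snoc (step f p) e = step f (snoc p e)

  reverseʷ : ∀ {k u v} → Walk G k u v → Walk G k v u
  reverseʷ stop       = stop
  reverseʷ (step e p) = snoc (reverseʷ p) (~-sym e)

-- Distances, transmissions and the Wiener index.

module _ {n : ℕ} (G : SimpleGraph n) (conn : Connected G) where
  open SimpleGraph G

  private
    δ : Fin n → Fin n → ℕ
    δ = d G conn

    τ : Fin n → ℕ
    τ = tr G conn

  geodesic : ∀ u v → Walk G (δ u v) u v
  geodesic u v = proj₁ (proj₂ (shortest G conn u v))

  d-minimal : ∀ {k u v} → Walk G k u v → δ u v ℕ.≤ k
  d-minimal {k} {u} {v} = proj₂ (proj₂ (shortest G conn u v)) k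

  d-refl : ∀ u → δ u u ≡ 0
  d-refl u = ℕP.n≤0⇒n≡0 (d-minimal {u = u} stop)

  d-sym-≤ : ∀ u v → δ u v ℕ.≤ δ v u
  d-sym-≤ u v = d-minimal (reverseʷ G (geodesic v u))

  d-sym : ∀ u v → δ u v ≡ δ v u
  d-sym u v = ℕP.≤-antisym (d-sym-≤ u v) (d-sym-≤ v u)

  d-triangle : ∀ u v w → δ u w ℕ.≤ δ u v ℕ.+ δ v w
  d-triangle u v w = d-minimal (_++ʷ_ G (geodesic u v) (geodesic v w))

  d-step : ∀ u {v w} → v ~ w → δ u w ℕ.≤ suc (δ u v)
  d-step u v~w = d-minimal (snoc G (geodesic u _) v~w)

  -- Sum the triangle inequality through w over all n vertices w.
  n*d≤tr+tr : ∀ u v → n ℕ.* δ u v ℕ.≤ τ u ℕ.+ τ v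
  n*d≤tr+tr u v = begin
    n ℕ.* δ u v                                   ≡⟨ cong (ℕ._* δ u v) (length-allFin n) ⟨
    length (allFin n) ℕ.* δ u v                   ≡⟨ sum-map-const (δ u v) (allFin n) ⟨
    sum (map (λ _ → δ u v) (allFin n))            ≤⟨ sum-map-mono triangle (allFin n) ⟩
    sum (map (λ w → δ u w ℕ.+ δ v w) (allFin n))  ≡⟨ sum-map-+ (δ u) (δ v) (allFin n) ⟩
    τ u ℕ.+ τ v                                   ∎
    where
    open ℕP.≤-Reasoning
    triangle : ∀ w → δ u v ℕ.≤ δ u w ℕ.+ δ v w
    triangle w = subst (λ k → δ u v ℕ.≤ δ u w ℕ.+ k) (d-sym w v) (d-triangle u w v)

  -- With `h` equal to the distance when u < v and 0 otherwise, W is the double sum of `h` and also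
  -- of its transpose. The two add up to the distance entry by entry, the diagonal being 0 on both
  -- sides.
  2W≡∑tr : 2 ℕ.* W G conn ≡ sum (map τ (allFin n))
  2W≡∑tr = begin
    2 ℕ.* W G conn
      ≡⟨ cong (W G conn ℕ.+_) (ℕP.+-identityʳ (W G conn)) ⟩
    W G conn ℕ.+ W G conn
      ≡⟨ cong₂ ℕ._+_ W≡∑h (trans W≡∑h (sum-map-swap h V V)) ⟩
    sum (map (λ u → sum (map (h u) V)) V) ℕ.+ sum (map (λ u → sum (map (λ v → h v u) V)) V)
      ≡⟨ sum-map-+ (λ u → sum (map (h u) V)) (λ u → sum (map (λ v → h v u) V)) V ⟨
    sum (map (λ u → sum (map (h u) V) ℕ.+ sum (map (λ v → h v u) V)) V)
      ≡⟨ cong sum (map-cong (λ u → trans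
           (sym (sum-map-+ (h u) (λ v → h v u) V))
           (cong sum (map-cong (h+h≡d u) V))) V) ⟩
    sum (map τ V) ∎
    where
    open ≡-Reasoning
    V = allFin n

    h : Fin n → Fin n → ℕ
    h u v = restrict (λ (u , v) → u FinP.<? v) (uncurry δ) (u , v)

    accept : ∀ {u v} → u Fin.< v → h u v ≡ δ u v
    accept = restrict-accept (λ (u , v) → u FinP.<? v) (uncurry δ)

    reject : ∀ {u v} → ¬ (u Fin.< v) → h u v ≡ 0
    reject = restrict-reject (λ (u , v) → u FinP.<? v) (uncurry δ)

    W≡∑h : W G conn ≡ sum (map (λ u → sum (map (h u) V)) V)
    W≡∑h = trans (sum-map-filter (λ (u , v) → u FinP.<? v) (uncurry δ) (cartesianProduct V V))
                 (sum-map-cartesianProduct (uncurry h) V V)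

    h+h≡d : ∀ u v → h u v ℕ.+ h v u ≡ δ u v
    h+h≡d u v with FinP.<-cmp u v
    ... | tri< u<v _ v≮u = trans (cong₂ ℕ._+_ (accept u<v) (reject v≮u)) (ℕP.+-identityʳ (δ u v))
    ... | tri≈ u≮u refl _ = trans (cong₂ ℕ._+_ (reject u≮u) (reject u≮u)) (sym (d-refl u))
    ... | tri> u≮v _ v<u = trans (cong₂ ℕ._+_ (reject u≮v) (accept v<u)) (d-sym v u)

  -- Choose u with the entry of largest absolute value and let s be its sign. Along geodesics
  -- `s * y u - s * y v` is at most d(u,v) times the spread; sum over v. The term with the sum of
  -- `y` absorbs the deviation from zero sum in a single term of a Cauchy sequence.
  max-deviation-≤ : ∀ {T} → (∀ u → τ u ℕ.≤ T) → Fin n → ∀ (y : Fin n → ℚ) →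
    ι n ℚ.* maxℚ (map (λ v → ℚ.∣ y v ∣) (allFin n)) ℚ.≤
    ℚ.∣ sumℚ (map y (allFin n)) ∣ ℚ.+ ι T ℚ.* spread G y
  max-deviation-≤ {T} τ≤T v₀ y
    with maxℚ-attained (λ v → ℚ.∣ y v ∣) (λ v → ℚP.0≤∣p∣ (y v)) v₀ (allFin n)
  ... | u , M≤∣yu∣ with sign (y u)
  ...   | s , s*yu≡∣yu∣ , s*≤∣∣ = begin
    ι n ℚ.* M
      ≤⟨ ℚP.*-monoˡ-≤-nonNeg (ι n) M≤c ⟩
    ι n ℚ.* c
      ≡⟨ solve 3 (λ a s S → a := s :* S :+ (a :- s :* S)) refl (ι n ℚ.* c) s S ⟩
    s ℚ.* S ℚ.+ (ι n ℚ.* c ℚ.- s ℚ.* S)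
      ≡⟨ cong (λ l → s ℚ.* S ℚ.+ (ι l ℚ.* c ℚ.- s ℚ.* S)) (length-allFin n) ⟨
    s ℚ.* S ℚ.+ (ι (length (allFin n)) ℚ.* c ℚ.- s ℚ.* S)
      ≤⟨ ℚP.+-mono-≤ (s*≤∣∣ S)
           (sum-deviation-≤ c s (spread G y) y (δ u) (allFin n)
             (λ v → walk-deviation-≤ G (λ v → s ℚ.* y v) edge (geodesic u v))) ⟩
    ℚ.∣ S ∣ ℚ.+ ι (τ u) ℚ.* spread G y
      ≤⟨ ℚP.+-monoʳ-≤ ℚ.∣ S ∣ (ℚP.*-monoʳ-≤-nonNeg (spread G y)
           {{ℚ.nonNegative (0≤maxℚ (λ (u , v) → ℚ.∣ y u ℚ.- y v ∣) (edges G))}}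
           (ι-mono (τ≤T u))) ⟩
    ℚ.∣ S ∣ ℚ.+ ι T ℚ.* spread G y ∎
    where
    open ℚP.≤-Reasoning
    M = maxℚ (map (λ v → ℚ.∣ y v ∣) (allFin n))
    S = sumℚ (map y (allFin n))
    c = s ℚ.* y u

    M≤c : M ℚ.≤ c
    M≤c = ℚP.≤-trans M≤∣yu∣ (ℚP.≤-reflexive (sym s*yu≡∣yu∣))

    edge : ∀ {v w} → v ~ w → s ℚ.* y v ℚ.- s ℚ.* y w ℚ.≤ spread G y
    edge {v} {w} v~w = ℚP.≤-trans
      (ℚP.≤-reflexive (solve 3 (λ s a b → s :* a :- s :* b := s :* (a :- b)) refl s (y v) (y w)))
      (ℚP.≤-trans (s*≤∣∣ (y v ℚ.- y w)) (edge≤spread G y v~w))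

-- The largest transmission T and the lower bound n/T.

module _ {n : ℕ} (G : SimpleGraph n) (conn : Connected G) (v₀ : Fin n)
         .{{2W≢0 : ℕ.NonZero (2 ℕ.* W G conn)}} where
  open SimpleGraph G

  private
    V : List (Fin n)
    V = allFin n

    τ : Fin n → ℕ
    τ = tr G conn

  -- The vertex c of largest transmission from which the extremal vector is built; `v₀` is the
  -- starting candidate of `argmax`.
  farthest : Fin n
  farthest = argmax τ v₀ V

  maxTr : ℕ
  maxTr = τ farthest

  tr≤maxTr : ∀ u → τ u ℕ.≤ maxTr
  tr≤maxTr u = All.lookup (f[xs]≤f[argmax] v₀ V) (∈-allFin u)

  ∑-const : ∀ k → sum (map (λ _ → k) V) ≡ n ℕ.* k
  ∑-const k = trans (sum-map-const k V) (cong (ℕ._* k) (length-allFin n))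

  2W≤n*maxTr : 2 ℕ.* W G conn ℕ.≤ n ℕ.* maxTr
  2W≤n*maxTr = subst₂ ℕ._≤_ (sym (2W≡∑tr G conn)) (∑-const maxTr) (sum-map-mono tr≤maxTr V)

  2W≡n*maxTr⇒regular : 2 ℕ.* W G conn ≡ n ℕ.* maxTr → TransmissionRegular G conn
  2W≡n*maxTr⇒regular eq u v = trans (τ≡maxTr u) (sym (τ≡maxTr v))
    where
    τ≡maxTr : ∀ w → τ w ≡ maxTr
    τ≡maxTr w = ℕP.≤-antisym (tr≤maxTr w) (sum-map-mono-tight tr≤maxTr
      (ℕP.≤-reflexive (trans (∑-const maxTr) (trans (sym eq) (2W≡∑tr G conn)))) (∈-allFin w))

  regular⇒2W≡n*maxTr : TransmissionRegular G conn → 2 ℕ.* W G conn ≡ n ℕ.* maxTr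
  regular⇒2W≡n*maxTr reg = trans (2W≡∑tr G conn)
    (trans (cong sum (map-cong (λ u → reg u farthest) V)) (∑-const maxTr))

  instance
    -- If T were 0, the bound 2W ≤ nT would force W to vanish.
    maxTr≢0 : ℕ.NonZero maxTr
    maxTr≢0 = ℕ.≢-nonZero λ maxTr≡0 → ℕ.≢-nonZero⁻¹ (2 ℕ.* W G conn)
      (ℕP.n≤0⇒n≡0 (ℕP.≤-trans 2W≤n*maxTr
        (ℕP.≤-reflexive (trans (cong (n ℕ.*_) maxTr≡0) (ℕP.*-zeroʳ n)))))

    ιmaxTr-pos : ℚ.Positive (ι maxTr)
    ιmaxTr-pos = ι-pos maxTr

  γℚ : ℚ
  γℚ = + n ℚ./ maxTr

  γℚ*maxTr≡n : γℚ ℚ.* ι maxTr ≡ ι n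
  γℚ*maxTr≡n = /-*-cancel n maxTr

  n≤g*maxTr⇒γℚ≤g : ∀ {g} → ι n ℚ.≤ ι maxTr ℚ.* g → γℚ ℚ.≤ g
  n≤g*maxTr⇒γℚ≤g {g} n≤ = ℚP.*-cancelʳ-≤-pos (ι maxTr)
    (subst₂ ℚ._≤_ (sym γℚ*maxTr≡n) (ℚP.*-comm (ι maxTr) g) n≤)

  γℚ-nonNeg : ℚ.NonNegative γℚ
  γℚ-nonNeg = ℚP.normalize-nonNeg n maxTr

  γ-lower-bound : ∀ x → 𝓕 n x → fromℚ γℚ ≤ γ[ x , G ]
  γ-lower-bound x (S≃0 , M≃1) ε 0<ε = N , λ k N≤k →
    n≤g*maxTr⇒γℚ≤g (main k (S≤δ k N≤k) (1≤M+δ k N≤k))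
    where
    open ℚP.≤-Reasoning

    δ : ℚ
    -- The sum contributes an error δ and the norm an error nδ. This choice makes their total (n +
    -- 1)δ equal to Tε, which becomes ε after division by T.
    δ = (+ maxTr ℚ./ suc n) ℚ.* ε

    0<δ : 0ℚ ℚ.< δ
    0<δ = ℚP.positive⁻¹ δ {{ℚP.pos*pos⇒pos (+ maxTr ℚ./ suc n)
      {{ℚP.normalize-pos maxTr (suc n)}} ε {{ℚ.positive 0<ε}}}}

    N₁ = proj₁ (S≃0 δ 0<δ)
    N₂ = proj₁ (M≃1 δ 0<δ)
    N = N₁ ℕ.⊔ N₂

    S M : ℕ → ℚ
    S k = sumℚ (map (λ v → seq (x v) k) V)
    M k = maxℚ (map (λ v → ℚ.∣ seq (x v) k ∣) V)

    S≤δ : ∀ k → N ℕ.≤ k → ℚ.∣ S k ∣ ℚ.≤ δ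
    S≤δ k N≤k = subst (λ s → ℚ.∣ s ∣ ℚ.≤ δ)
      (trans (ℚP.+-identityʳ _) (seq-sumℝ x V k))
      (proj₂ (S≃0 δ 0<δ) k (ℕP.m⊔n≤o⇒m≤o N₁ N₂ N≤k))

    1≤M+δ : ∀ k → N ℕ.≤ k → 1ℚ ℚ.≤ M k ℚ.+ δ
    1≤M+δ k N≤k = ℚP.≤-trans (c≤a+∣a-c∣ (M k) 1ℚ) (ℚP.+-monoʳ-≤ (M k)
      (subst (λ m → ℚ.∣ m ℚ.- 1ℚ ∣ ℚ.≤ δ) (seq-maxℝ (λ v → ∣ x v ∣) V k)
        (proj₂ (M≃1 δ 0<δ) k (ℕP.m⊔n≤o⇒n≤o N₁ N₂ N≤k))))

    main : ∀ k → ℚ.∣ S k ∣ ℚ.≤ δ → 1ℚ ℚ.≤ M k ℚ.+ δ →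
           ι n ℚ.≤ ι maxTr ℚ.* (seq γ[ x , G ] k ℚ.+ ε)
    main k S≤ 1≤ = begin
      ι n
        ≡⟨ ℚP.*-identityʳ (ι n) ⟨
      ι n ℚ.* 1ℚ
        ≤⟨ ℚP.*-monoˡ-≤-nonNeg (ι n) 1≤ ⟩
      ι n ℚ.* (M k ℚ.+ δ)
        ≡⟨ ℚP.*-distribˡ-+ (ι n) (M k) δ ⟩
      ι n ℚ.* M k ℚ.+ ι n ℚ.* δ
        ≤⟨ ℚP.+-monoˡ-≤ (ι n ℚ.* δ) (max-deviation-≤ G conn tr≤maxTr v₀ (λ v → seq (x v) k)) ⟩
      ℚ.∣ S k ∣ ℚ.+ ι maxTr ℚ.* g ℚ.+ ι n ℚ.* δ
        ≤⟨ ℚP.+-monoˡ-≤ (ι n ℚ.* δ) (ℚP.+-monoˡ-≤ (ι maxTr ℚ.* g) S≤) ⟩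
      δ ℚ.+ ι maxTr ℚ.* g ℚ.+ ι n ℚ.* δ
        ≡⟨ solve 5 (λ p e T g l → p :* e :+ T :* g :+ l :* (p :* e)
                                := T :* g :+ p :* (con 1ℚ :+ l) :* e)
             refl (+ maxTr ℚ./ suc n) ε (ι maxTr) g (ι n) ⟩
      ι maxTr ℚ.* g ℚ.+ (+ maxTr ℚ./ suc n) ℚ.* (1ℚ ℚ.+ ι n) ℚ.* ε
        ≡⟨ cong (λ i → ι maxTr ℚ.* g ℚ.+ (+ maxTr ℚ./ suc n) ℚ.* i ℚ.* ε) (ι-+ 1 n) ⟨
      ι maxTr ℚ.* g ℚ.+ (+ maxTr ℚ./ suc n) ℚ.* ι (suc n) ℚ.* ε
        ≡⟨ cong (λ i → ι maxTr ℚ.* g ℚ.+ i ℚ.* ε) (/-*-cancel maxTr (suc n)) ⟩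
      ι maxTr ℚ.* g ℚ.+ ι maxTr ℚ.* ε
        ≡⟨ ℚP.*-distribˡ-+ (ι maxTr) g ε ⟨
      ι maxTr ℚ.* (g ℚ.+ ε)
        ≡⟨ cong (λ g → ι maxTr ℚ.* (g ℚ.+ ε))
             (seq-maxℝ (λ (u , v) → ∣ x u - x v ∣) (edges G) k) ⟨
      ι maxTr ℚ.* (seq γ[ x , G ] k ℚ.+ ε) ∎
      where
      g = spread G (λ v → seq (x v) k)

  -- The extremal vector and attainment of the minimum.

  potential : Fin n → ℚ
  potential v = 1ℚ ℚ.- γℚ ℚ.* ι (d G conn farthest v)

  sum-potential : sumℚ (map potential V) ≡ 0ℚ
  sum-potential = begin
    sumℚ (map potential V)
      ≡⟨ sum-affine γℚ (d G conn farthest) V ⟩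
    ι (length V) ℚ.- γℚ ℚ.* ι maxTr
      ≡⟨ cong₂ (λ l r → ι l ℚ.- r) (length-allFin n) γℚ*maxTr≡n ⟩
    ι n ℚ.- ι n
      ≡⟨ ℚP.+-inverseʳ (ι n) ⟩
    0ℚ ∎
    where open ≡-Reasoning

  potential-farthest : potential farthest ≡ 1ℚ
  potential-farthest = trans
    (cong (λ k → 1ℚ ℚ.- γℚ ℚ.* ι k) (d-refl G conn farthest))
    (solve 1 (λ q → con 1ℚ :- q :* con 0ℚ := con 1ℚ) refl γℚ)

  -- Multiplied by T, this is `n*d≤tr+tr` with both transmissions bounded by T. It keeps the entries
  -- of `potential` from falling below -1.
  γℚ*d≤2 : ∀ u v → γℚ ℚ.* ι (d G conn u v) ℚ.≤ 1ℚ ℚ.+ 1ℚ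
  γℚ*d≤2 u v = ℚP.*-cancelʳ-≤-pos (ι maxTr) (begin
    γℚ ℚ.* ι k ℚ.* ι maxTr
      ≡⟨ solve 3 (λ q k T → q :* k :* T := q :* T :* k) refl γℚ (ι k) (ι maxTr) ⟩
    γℚ ℚ.* ι maxTr ℚ.* ι k
      ≡⟨ cong (ℚ._* ι k) γℚ*maxTr≡n ⟩
    ι n ℚ.* ι k
      ≡⟨ ι-* n k ⟨
    ι (n ℕ.* k)
      ≤⟨ ι-mono (ℕP.≤-trans (n*d≤tr+tr G conn u v) (ℕP.+-mono-≤ (tr≤maxTr u) (tr≤maxTr v))) ⟩
    ι (maxTr ℕ.+ maxTr)
      ≡⟨ ι-+ maxTr maxTr ⟩
    ι maxTr ℚ.+ ι maxTr
      ≡⟨ solve 1 (λ T → T :+ T := (con 1ℚ :+ con 1ℚ) :* T) refl (ι maxTr) ⟩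
    (1ℚ ℚ.+ 1ℚ) ℚ.* ι maxTr ∎)
    where
    open ℚP.≤-Reasoning
    k = d G conn u v

  ∣potential∣≤1 : ∀ v → ℚ.∣ potential v ∣ ℚ.≤ 1ℚ
  ∣potential∣≤1 v = subst (λ p → ℚ.∣ p ∣ ℚ.≤ 1ℚ) (ℚP.+-identityʳ (potential v)) (∣a-c∣≤ upper lower)
    where
    open ℚP.≤-Reasoning
    k = d G conn farthest v

    upper : potential v ℚ.≤ 0ℚ ℚ.+ 1ℚ
    upper = ℚP.+-monoʳ-≤ 1ℚ (ℚP.neg-antimono-≤
      (subst (ℚ._≤ γℚ ℚ.* ι k) (ℚP.*-zeroʳ γℚ)
        (ℚP.*-monoˡ-≤-nonNeg γℚ {{γℚ-nonNeg}} (ι-mono {n = k} ℕ.z≤n))))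

    lower : 0ℚ ℚ.≤ potential v ℚ.+ 1ℚ
    lower = begin
      0ℚ
        ≡⟨ ℚP.+-inverseʳ (γℚ ℚ.* ι k) ⟨
      γℚ ℚ.* ι k ℚ.- γℚ ℚ.* ι k
        ≤⟨ ℚP.+-monoˡ-≤ (ℚ.- (γℚ ℚ.* ι k)) (γℚ*d≤2 farthest v) ⟩
      1ℚ ℚ.+ 1ℚ ℚ.- γℚ ℚ.* ι k
        ≡⟨ solve 1 (λ r → con 1ℚ :+ con 1ℚ :- r := con 1ℚ :- r :+ con 1ℚ) refl (γℚ ℚ.* ι k) ⟩
      potential v ℚ.+ 1ℚ ∎

  max-potential : maxℚ (map (λ v → ℚ.∣ potential v ∣) V) ≡ 1ℚ
  max-potential = ℚP.≤-antisym
    (maxℚ-lub (λ v → ℚ.∣ potential v ∣) V (ℚP.nonNegative⁻¹ 1ℚ) (λ {v} _ → ∣potential∣≤1 v))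
    (subst (λ p → ℚ.∣ p ∣ ℚ.≤ maxℚ (map (λ v → ℚ.∣ potential v ∣) V)) potential-farthest
      (∈⇒≤maxℚ (λ v → ℚ.∣ potential v ∣) (∈-allFin farthest)))

  -- Crossing an edge raises the distance from c by at most 1, hence lowers the potential by at most
  -- n/T.
  potential-step : ∀ {v w} → v ~ w → potential v ℚ.≤ potential w ℚ.+ γℚ
  potential-step {v} {w} v~w = begin
    1ℚ ℚ.- γℚ ℚ.* ι k
      ≡⟨ solve 2 (λ q k → con 1ℚ :- q :* k := con 1ℚ :- q :* (con 1ℚ :+ k) :+ q) refl γℚ (ι k) ⟩
    1ℚ ℚ.- γℚ ℚ.* (1ℚ ℚ.+ ι k) ℚ.+ γℚ
      ≡⟨ cong (λ i → 1ℚ ℚ.- γℚ ℚ.* i ℚ.+ γℚ) (ι-+ 1 k) ⟨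
    1ℚ ℚ.- γℚ ℚ.* ι (suc k) ℚ.+ γℚ
      ≤⟨ ℚP.+-monoˡ-≤ γℚ (ℚP.+-monoʳ-≤ 1ℚ (ℚP.neg-antimono-≤
           (ℚP.*-monoˡ-≤-nonNeg γℚ {{γℚ-nonNeg}} (ι-mono (d-step G conn farthest v~w))))) ⟩
    potential w ℚ.+ γℚ ∎
    where
    open ℚP.≤-Reasoning
    k = d G conn farthest v

  -- The upper half applies `potential-step` in both directions of an edge. The lower half is
  -- `max-deviation-≤` at sum 0 and maximum 1, in place of exhibiting an edge with difference n/T.
  spread-potential : spread G potential ≡ γℚ
  spread-potential = ℚP.≤-antisym
    (spread≤ G potential (ℚP.nonNegative⁻¹ γℚ {{γℚ-nonNeg}})
      (λ v~w → ∣a-c∣≤ (potential-step v~w) (potential-step (~-sym v~w))))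
    (n≤g*maxTr⇒γℚ≤g (begin
      ι n
        ≡⟨ ℚP.*-identityʳ (ι n) ⟨
      ι n ℚ.* 1ℚ
        ≡⟨ cong (ι n ℚ.*_) max-potential ⟨
      ι n ℚ.* maxℚ (map (λ v → ℚ.∣ potential v ∣) V)
        ≤⟨ max-deviation-≤ G conn tr≤maxTr v₀ potential ⟩
      ℚ.∣ sumℚ (map potential V) ∣ ℚ.+ ι maxTr ℚ.* spread G potential
        ≡⟨ cong (λ s → ℚ.∣ s ∣ ℚ.+ ι maxTr ℚ.* spread G potential) sum-potential ⟩
      0ℚ ℚ.+ ι maxTr ℚ.* spread G potential
        ≡⟨ ℚP.+-identityˡ _ ⟩
      ι maxTr ℚ.* spread G potential ∎))
    where open ℚP.≤-Reasoning

  n/maxTr-is-γ : Is-γ G (fromℚ γℚ)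
  n/maxTr-is-γ = (x , (sum≃0 , norm≃1) , attains) , γ-lower-bound
    where
    x : Fin n → ℝ
    x v = fromℚ (potential v)

    sum≃0 : sumℝ (map x V) ≃ 0ℝ
    sum≃0 = pointwise⇒≃ {sumℝ (map x V)} {0ℝ} λ k → trans (seq-sumℝ x V k) sum-potential

    norm≃1 : ‖ x ‖∞ ≃ 1ℝ
    norm≃1 = pointwise⇒≃ {‖ x ‖∞} {1ℝ} λ k →
      trans (seq-maxℝ (λ v → ∣ x v ∣) V k) max-potential

    attains : γ[ x , G ] ≃ fromℚ γℚ
    attains = pointwise⇒≃ {γ[ x , G ]} {fromℚ γℚ} λ k →
      trans (seq-maxℝ (λ (u , v) → ∣ x u - x v ∣) (edges G) k) spread-potential

  -- Comparison of n/T with the Wiener index bound.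

  bound : ℚ
  bound = + (n ℕ.^ 2) ℚ./ (2 ℕ.* W G conn)

  n²*k≡n*[n*k] : ∀ k → n ℕ.^ 2 ℕ.* k ≡ n ℕ.* (n ℕ.* k)
  n²*k≡n*[n*k] k = trans (cong (λ m → n ℕ.* m ℕ.* k) (ℕP.*-identityʳ n)) (ℕP.*-assoc n n k)

  -- After cross-multiplication this is n times the inequality 2W ≤ nT.
  γℚ≤bound : γℚ ℚ.≤ bound
  γℚ≤bound = /-mono-≤ n (n ℕ.^ 2) maxTr (2 ℕ.* W G conn)
    (subst (n ℕ.* (2 ℕ.* W G conn) ℕ.≤_) (sym (n²*k≡n*[n*k] maxTr))
      (ℕP.*-monoʳ-≤ n 2W≤n*maxTr))

  -- Cross-multiplication gives n · 2W = n · (nT), and cancelling the nonzero n leaves the equality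
  -- case of 2W ≤ nT.
  γℚ≡bound⇒regular : .{{ℕ.NonZero n}} → γℚ ≡ bound → TransmissionRegular G conn
  γℚ≡bound⇒regular eq = 2W≡n*maxTr⇒regular (ℕP.*-cancelˡ-≡ (2 ℕ.* W G conn) (n ℕ.* maxTr) n
    (trans (/-injective-≃ n (n ℕ.^ 2) maxTr (2 ℕ.* W G conn) eq) (n²*k≡n*[n*k] maxTr)))

  regular⇒γℚ≡bound : TransmissionRegular G conn → γℚ ≡ bound
  regular⇒γℚ≡bound reg = ℚP.≤-antisym γℚ≤bound
    (/-mono-≤ (n ℕ.^ 2) n (2 ℕ.* W G conn) maxTr (ℕP.≤-reflexive
      (trans (n²*k≡n*[n*k] maxTr) (cong (n ℕ.*_) (sym (regular⇒2W≡n*maxTr reg))))))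

theorem4p2 : (n : ℕ) (n≥2 : 2 ℕ.≤ n) (G : SimpleGraph n) (conn : Connected G) →
    let bound = fromℚ (ℚ._/_ (+ (n ℕ.^ 2)) (2 ℕ.* W G conn) {{2W≢0 n≥2 G conn}}) in
    ∃ λ γ → Is-γ G γ × γ ≤ bound × (γ ≃ bound ⇔ TransmissionRegular G conn)
theorem4p2 n n≥2 G conn =
  fromℚ q , n/maxTr-is-γ G conn v₀ ,
  pointwise⇒≤ {fromℚ q} {fromℚ r} (λ _ → γℚ≤bound G conn v₀) ,
  mk⇔ (λ q≃r → γℚ≡bound⇒regular G conn v₀ (fromℚ-injective {q} {r} q≃r))
      (λ reg → pointwise⇒≃ {fromℚ q} {fromℚ r} (λ _ → regular⇒γℚ≡bound G conn v₀ reg))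
  where
  v₀ : Fin n
  -- `2 ≤ n` unfolds to `1 < n`, so this is the vertex with index 1.
  v₀ = Fin.fromℕ< n≥2

  instance
    2W-nonZero : ℕ.NonZero (2 ℕ.* W G conn)
    2W-nonZero = 2W≢0 n≥2 G conn

    n-nonZero : ℕ.NonZero n
    n-nonZero = FinP.nonZeroIndex v₀

  q r : ℚ
  q = γℚ G conn v₀
  r = bound G conn v₀
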